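{- Let $\mathcal{S}$ be any finite nonempty set of points in $\mathbb{E}^2$. If the points of $\mathbb{E}^2$ are colored in finitely many colors (i.e. $\chi:\mathbb{E}^2\to\{1,\ldots,c\}$ is an arbitrary function for some positive integer $c$), then there exists a family of cardinality $2^{\aleph_0}$ of pairwise-disjoint subsets of $\mathbb{E}^2$, each of which is monochromatic and homothetic to $\mathcal{S}$.
   Context: $\mathbb{E}^2$ denotes the Euclidean plane (i.e. $\mathbb{R}^2$). For $\mathcal{X}\subseteq\mathbb{E}^2$, $b\in\mathbb{R}$ and $\mathbf{a}\in\mathbb{E}^2$, $\mathbf{a}+b\mathcal{X}=\{\mathbf{a}+b\mathbf{x}:\mathbf{x}\in\mathcal{X}\}$. A subset of $\mathbb{E}^2$ is homothetic to $\mathcal{S}$ if it is of the form $\mathbf{a}+b\mathcal{S}$ for some $\mathbf{a}\in\mathbb{E}^2$ and some $b\in\mathbb{R}$ with $b\neq 0$. A set is monochromatic if all its points receive the same color. -}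

module Defs where

open import Algebra.Bundles using (AbelianGroup)
open import Level using (0ℓ; suc)
open import Data.Nat.Base as ℕ using (ℕ; _⊔_)
import Data.Nat.Properties as ℕ
open import Data.Rational.Base as ℚ
  using (ℚ; 0ℚ; 1ℚ; ½; ∣_∣; Positive; 1/_)
import Data.Rational.Properties as ℚ
import Algebra.Properties.AbelianGroup ℚ.+-0-abelianGroup as +
import Algebra.Properties.CommutativeSemigroup as CommutativeSemigroup
import Algebra.Properties.Ring ℚ.+-*-ring as Ring
open import Data.Bool.Base using (Bool)
open import Data.Fin.Base using (Fin)
open import Data.List.Base using (List)
import Data.List.Membership.Setoid as Membership
open import Data.Product.Base using (∃; ∃₂; _×_; _,_; proj₁; proj₂)
open import Data.Product.Relation.Binary.Pointwise.NonDependent using (_×ₛ_)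
open import Function.Bundles using (Bijection; Func; _⟶ₛ_; _⇔_)
open import Relation.Binary.Bundles using (Setoid)
import Relation.Binary.Construct.On as On
open import Relation.Binary.PropositionalEquality
  using (_≡_; sym; trans; cong; cong₂; subst; setoid; _→-setoid_; module ≡-Reasoning)
open import Relation.Nullary.Negation using (¬_)
open import Relation.Unary using (Pred; _∈_; _≐_; _⊥_)
open import Relation.Unary.Relation.Binary.Equality using (≐-setoid)

-- Cauchy sequences of rationals modulo null sequences.
--
-- The modulus of convergence contained in a proof of IsCauchy is not
-- seen by _≃_, so it is not part of the real number.

IsCauchy : (ℕ → ℚ) → Set
IsCauchy x = ∀ ε → 0ℚ ℚ.< ε →
  ∃ λ N → ∀ m n → N ℕ.≤ m → N ℕ.≤ n → ∣ x m ℚ.- x n ∣ ℚ.< ε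

record ℝ : Set where
  constructor mkℝ
  field
    seq      : ℕ → ℚ
    isCauchy : IsCauchy seq

open ℝ public

infix 4 _≃_

_≃_ : ℝ → ℝ → Set
x ≃ y = ∀ ε → 0ℚ ℚ.< ε →
  ∃ λ N → ∀ n → N ℕ.≤ n → ∣ seq x n ℚ.- seq y n ∣ ℚ.< ε

private
  p-p≡0 : ∀ p → ∣ p ℚ.- p ∣ ≡ 0ℚ
  p-p≡0 p = cong ∣_∣ (ℚ.+-inverseʳ p)

  ∣p-q∣≡∣q-p∣ : ∀ p q → ∣ p ℚ.- q ∣ ≡ ∣ q ℚ.- p ∣
  ∣p-q∣≡∣q-p∣ p q = trans (sym (ℚ.∣-p∣≡∣p∣ (p ℚ.- q))) (cong ∣_∣ (+.⁻¹-anti-homo-// p q))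

  telescope : ∀ p q r → (p ℚ.- q) ℚ.+ (q ℚ.- r) ≡ p ℚ.- r
  telescope p q r = trans (sym (ℚ.+-assoc (p ℚ.- q) q (ℚ.- r)))
    (cong (ℚ._- r) (+.//-rightDividesˡ q p))

  +-difference : ∀ p q r s → (p ℚ.- q) ℚ.+ (r ℚ.- s) ≡ (p ℚ.+ r) ℚ.- (q ℚ.+ s)
  +-difference p q r s = trans
    (CommutativeSemigroup.interchange +-commutativeSemigroup p (ℚ.- q) r (ℚ.- s))
    (cong ((p ℚ.+ r) ℚ.+_) (+.⁻¹-∙-comm q s))
    where open AbelianGroup ℚ.+-0-abelianGroup
            using () renaming (commutativeSemigroup to +-commutativeSemigroup)

  *-difference : ∀ p q r s → p ℚ.* (r ℚ.- s) ℚ.+ s ℚ.* (p ℚ.- q) ≡ p ℚ.* r ℚ.- q ℚ.* s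
  *-difference p q r s = begin
    p ℚ.* (r ℚ.- s) ℚ.+ s ℚ.* (p ℚ.- q)
      ≡⟨ cong₂ ℚ._+_ (Ring.x[y-z]≈xy-xz p r s) (Ring.x[y-z]≈xy-xz s p q) ⟩
    (p ℚ.* r ℚ.- p ℚ.* s) ℚ.+ (s ℚ.* p ℚ.- s ℚ.* q)
      ≡⟨ cong₂ (λ t u → (p ℚ.* r ℚ.- p ℚ.* s) ℚ.+ (t ℚ.- u)) (ℚ.*-comm s p) (ℚ.*-comm s q) ⟩
    (p ℚ.* r ℚ.- p ℚ.* s) ℚ.+ (p ℚ.* s ℚ.- q ℚ.* s)
      ≡⟨ telescope (p ℚ.* r) (p ℚ.* s) (q ℚ.* s) ⟩
    p ℚ.* r ℚ.- q ℚ.* s ∎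
    where open ≡-Reasoning
  
  half+half : ∀ ε → ½ ℚ.* ε ℚ.+ ½ ℚ.* ε ≡ ε
  half+half ε = trans (sym (ℚ.*-distribʳ-+ ε ½ ½)) (ℚ.*-identityˡ ε)

  half-pos : ∀ {ε} → 0ℚ ℚ.< ε → 0ℚ ℚ.< ½ ℚ.* ε
  half-pos {ε} 0<ε =
    subst (ℚ._< ½ ℚ.* ε) (ℚ.*-zeroʳ ½) (ℚ.*-monoʳ-<-pos ½ 0<ε)

  ∣p+q∣<ε : ∀ {ε} p q → ∣ p ∣ ℚ.< ½ ℚ.* ε → ∣ q ∣ ℚ.< ½ ℚ.* ε → ∣ p ℚ.+ q ∣ ℚ.< ε
  ∣p+q∣<ε {ε} p q p<½ε q<½ε = subst (∣ p ℚ.+ q ∣ ℚ.<_) (half+half ε)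
    (ℚ.≤-<-trans (ℚ.∣p+q∣≤∣p∣+∣q∣ p q) (ℚ.+-mono-< p<½ε q<½ε))

≃-refl : ∀ {x} → x ≃ x
≃-refl {x} ε 0<ε = 0 , λ n _ → subst (ℚ._< ε) (sym (p-p≡0 (seq x n))) 0<ε

≃-sym : ∀ {x y} → x ≃ y → y ≃ x
≃-sym {x} {y} x≃y ε 0<ε with x≃y ε 0<ε
... | N , p = N , λ n N≤n →
  subst (ℚ._< ε) (∣p-q∣≡∣q-p∣ (seq x n) (seq y n)) (p n N≤n)

≃-trans : ∀ {x y z} → x ≃ y → y ≃ z → x ≃ z
≃-trans {x} {y} {z} x≃y y≃z ε 0<ε
  with x≃y (½ ℚ.* ε) (half-pos 0<ε) | y≃z (½ ℚ.* ε) (half-pos 0<ε)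
... | M , p | N , q = M ⊔ N , λ n M⊔N≤n →
  subst (λ r → ∣ r ∣ ℚ.< ε)
    (telescope (seq x n) (seq y n) (seq z n))
    (∣p+q∣<ε (seq x n ℚ.- seq y n) (seq y n ℚ.- seq z n)
      (p n (ℕ.≤-trans (ℕ.m≤m⊔n M N) M⊔N≤n))
      (q n (ℕ.≤-trans (ℕ.m≤n⊔m M N) M⊔N≤n)))

ℝₛ : Setoid 0ℓ 0ℓ
ℝₛ = record
  { Carrier       = ℝ
  ; _≈_           = _≃_
  ; isEquivalence = record
    { refl  = λ {x} → ≃-refl {x}
    ; sym   = λ {x} {y} → ≃-sym {x} {y}
    ; trans = λ {x} {y} {z} → ≃-trans {x} {y} {z}
    }
  }

0ℝ : ℝ
0ℝ = mkℝ (λ _ → 0ℚ) (λ ε 0<ε → 0 , λ _ _ _ _ → 0<ε)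

infixl 6 _+_
infixl 7 _*_

_+_ : ℝ → ℝ → ℝ
mkℝ x cx + mkℝ y cy = mkℝ (λ n → x n ℚ.+ y n) cauchy
  where
  cauchy : IsCauchy (λ n → x n ℚ.+ y n)
  cauchy ε 0<ε with cx (½ ℚ.* ε) (half-pos 0<ε) | cy (½ ℚ.* ε) (half-pos 0<ε)
  ... | M , p | N , q = M ⊔ N , λ m n M⊔N≤m M⊔N≤n →
    subst (λ r → ∣ r ∣ ℚ.< ε)
      (+-difference (x m) (x n) (y m) (y n))
      (∣p+q∣<ε (x m ℚ.- x n) (y m ℚ.- y n)
        (p m n (ℕ.≤-trans (ℕ.m≤m⊔n M N) M⊔N≤m) (ℕ.≤-trans (ℕ.m≤m⊔n M N) M⊔N≤n))
        (q m n (ℕ.≤-trans (ℕ.m≤n⊔m M N) M⊔N≤m) (ℕ.≤-trans (ℕ.m≤n⊔m M N) M⊔N≤n)))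

private
  eventuallyBounded : ∀ {x} → IsCauchy x →
    ∃₂ λ B N → Positive B × (∀ n → N ℕ.≤ n → ∣ x n ∣ ℚ.≤ B)
  eventuallyBounded {x} cx with cx 1ℚ (ℚ.positive⁻¹ 1ℚ)
  ... | N , p = 1ℚ ℚ.+ ∣ x N ∣ , N ,
    ℚ.pos+nonNeg⇒pos 1ℚ ∣ x N ∣ {{ℚ.nonNegative (ℚ.0≤∣p∣ (x N))}} ,
    λ n N≤n → subst (λ r → ∣ r ∣ ℚ.≤ 1ℚ ℚ.+ ∣ x N ∣)
      (+.//-rightDividesˡ (x N) (x n))
      (ℚ.≤-trans (ℚ.∣p+q∣≤∣p∣+∣q∣ (x n ℚ.- x N) (x N))
        (ℚ.+-monoˡ-≤ ∣ x N ∣ (ℚ.<⇒≤ (p n N N≤n ℕ.≤-refl))))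
  
  -- With δ = (ε / 2) / B, a factor bounded by B times one below δ is below ε / 2.
  quotient : ℚ → ∀ B → .{{Positive B}} → ℚ
  quotient ε B = (1/ B) {{ℚ.pos⇒nonZero B}} ℚ.* (½ ℚ.* ε)

  quotient-pos : ∀ {ε} B .{{_ : Positive B}} → 0ℚ ℚ.< ε → 0ℚ ℚ.< quotient ε B
  quotient-pos {ε} B 0<ε = subst (ℚ._< quotient ε B) (ℚ.*-zeroʳ B⁻¹)
    (ℚ.*-monoʳ-<-pos B⁻¹ {{ℚ.1/pos⇒pos B}} (half-pos 0<ε))
    where B⁻¹ = (1/ B) {{ℚ.pos⇒nonZero B}}

  ∣p*q∣<½ε : ∀ {ε} B .{{_ : Positive B}} p q →
    ∣ p ∣ ℚ.≤ B → ∣ q ∣ ℚ.< quotient ε B → ∣ p ℚ.* q ∣ ℚ.< ½ ℚ.* ε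
  ∣p*q∣<½ε {ε} B p q p≤B q<δ = begin-strict
    ∣ p ℚ.* q ∣                ≡⟨ ℚ.∣p*q∣≡∣p∣*∣q∣ p q ⟩
    ∣ p ∣ ℚ.* ∣ q ∣            ≤⟨ ℚ.*-monoʳ-≤-nonNeg ∣ q ∣ {{ℚ.nonNegative (ℚ.0≤∣p∣ q)}} p≤B ⟩
    B ℚ.* ∣ q ∣                <⟨ ℚ.*-monoʳ-<-pos B q<δ ⟩
    B ℚ.* (B⁻¹ ℚ.* (½ ℚ.* ε))  ≡⟨ sym (ℚ.*-assoc B B⁻¹ (½ ℚ.* ε)) ⟩
    (B ℚ.* B⁻¹) ℚ.* (½ ℚ.* ε)  ≡⟨ cong (ℚ._* (½ ℚ.* ε)) (ℚ.*-inverseʳ B {{ℚ.pos⇒nonZero B}}) ⟩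
    1ℚ ℚ.* (½ ℚ.* ε)           ≡⟨ ℚ.*-identityˡ (½ ℚ.* ε) ⟩
    ½ ℚ.* ε                    ∎
    where
    open ℚ.≤-Reasoning
    B⁻¹ = (1/ B) {{ℚ.pos⇒nonZero B}}

_*_ : ℝ → ℝ → ℝ
mkℝ x cx * mkℝ y cy = mkℝ (λ n → x n ℚ.* y n) cauchy
  where
  cauchy : IsCauchy (λ n → x n ℚ.* y n)
  cauchy ε 0<ε with eventuallyBounded cx | eventuallyBounded cy
  ... | B , K , B>0 , x≤B | C , L , C>0 , y≤C
    with cx (quotient ε C {{C>0}}) (quotient-pos C {{C>0}} 0<ε)
       | cy (quotient ε B {{B>0}}) (quotient-pos B {{B>0}} 0<ε)
  ... | M , p | N , q = (K ⊔ L) ⊔ (M ⊔ N) , λ m n ≤m ≤n →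
    subst (λ r → ∣ r ∣ ℚ.< ε)
      (*-difference (x m) (x n) (y m) (y n))
      (∣p+q∣<ε (x m ℚ.* (y m ℚ.- y n)) (y n ℚ.* (x m ℚ.- x n))
        (∣p*q∣<½ε {ε} B {{B>0}} (x m) (y m ℚ.- y n) (x≤B m (K≤ ≤m)) (q m n (N≤ ≤m) (N≤ ≤n)))
        (∣p*q∣<½ε {ε} C {{C>0}} (y n) (x m ℚ.- x n) (y≤C n (L≤ ≤n)) (p m n (M≤ ≤m) (M≤ ≤n))))
    where
    KL≤ : ∀ {n} → (K ⊔ L) ⊔ (M ⊔ N) ℕ.≤ n → K ⊔ L ℕ.≤ n
    KL≤ = ℕ.≤-trans (ℕ.m≤m⊔n (K ⊔ L) (M ⊔ N))
    MN≤ : ∀ {n} → (K ⊔ L) ⊔ (M ⊔ N) ℕ.≤ n → M ⊔ N ℕ.≤ n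
    MN≤ = ℕ.≤-trans (ℕ.m≤n⊔m (K ⊔ L) (M ⊔ N))
    K≤ : ∀ {n} → (K ⊔ L) ⊔ (M ⊔ N) ℕ.≤ n → K ℕ.≤ n
    K≤ h = ℕ.≤-trans (ℕ.m≤m⊔n K L) (KL≤ h)
    L≤ : ∀ {n} → (K ⊔ L) ⊔ (M ⊔ N) ℕ.≤ n → L ℕ.≤ n
    L≤ h = ℕ.≤-trans (ℕ.m≤n⊔m K L) (KL≤ h)
    M≤ : ∀ {n} → (K ⊔ L) ⊔ (M ⊔ N) ℕ.≤ n → M ℕ.≤ n
    M≤ h = ℕ.≤-trans (ℕ.m≤m⊔n M N) (MN≤ h)
    N≤ : ∀ {n} → (K ⊔ L) ⊔ (M ⊔ N) ℕ.≤ n → N ℕ.≤ n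
    N≤ h = ℕ.≤-trans (ℕ.m≤n⊔m M N) (MN≤ h)

𝔼²ₛ : Setoid 0ℓ 0ℓ
𝔼²ₛ = ℝₛ ×ₛ ℝₛ

open Setoid 𝔼²ₛ public using (_≈_) renaming (Carrier to 𝔼²)
open Membership 𝔼²ₛ using () renaming (_∈_ to _∈ₗ_)

infixl 6 _+ᵥ_
infixr 7 _•_

_+ᵥ_ : 𝔼² → 𝔼² → 𝔼²
(x , y) +ᵥ (x′ , y′) = x + x′ , y + y′

_•_ : ℝ → 𝔼² → 𝔼²
b • (x , y) = b * x , b * y

-- Predicates are not required to respect _≈_. Those satisfying
-- IsFinite, or HomotheticTo another set, do so automatically.

Subset : Set₁
Subset = Pred 𝔼² 0ℓ

IsFinite : Subset → Set
IsFinite 𝒳 = ∃ λ (xs : List 𝔼²) → ∀ p → p ∈ 𝒳 ⇔ p ∈ₗ xs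

homothet : 𝔼² → ℝ → Subset → Subset
homothet a b 𝒳 p = ∃ λ x → x ∈ 𝒳 × p ≈ a +ᵥ b • x

_HomotheticTo_ : Subset → Subset → Set
𝒳 HomotheticTo 𝒮 = ∃₂ λ a b → ¬ (b ≃ 0ℝ) × 𝒳 ≐ homothet a b 𝒮

-- A function on the plane is a setoid function: equal points get the
-- same colour.

Colouring : ℕ → Set
Colouring c = 𝔼²ₛ ⟶ₛ setoid (Fin c)

Monochromatic : ∀ {c} → Colouring c → Subset → Set
Monochromatic χ 𝒳 = ∃ λ k → ∀ {p} → p ∈ 𝒳 → Func.to χ p ≡ k

-- A family is a set of subsets of the plane, so members with the same
-- points are identified.

Family : Set₂
Family = Pred Subset (suc 0ℓ)

Members : Family → Setoid (suc 0ℓ) 0ℓ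
Members 𝓕 = On.setoid {B = ∃ 𝓕} (≐-setoid 𝔼² 0ℓ) proj₁

PairwiseDisjoint : Family → Set₁
PairwiseDisjoint 𝓕 = ∀ {X Y} → X ∈ 𝓕 → Y ∈ 𝓕 → ¬ (X ≐ Y) → X ⊥ Y

-- The cardinal 2^ℵ₀ is that of the set of functions ℕ → {0,1}.

HasCardinality2^ℵ₀ : Family → Set₁
HasCardinality2^ℵ₀ 𝓕 = Bijection (ℕ →-setoid Bool) (Members 𝓕)

{-# OPTIONS --safe #-}
module Submission where

-- The plane is sampled on the points a + Σⱼ s(wⱼ), where s lists 𝒮 and w is a
-- word of length N over the indices of 𝒮: a combinatorial line of words becomes
-- a homothetic copy of 𝒮 whose ratio is the number of active coordinates, so
-- Hales–Jewett yields a monochromatic copy for every base point a. The base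
-- points run over a Cantor set { Σ t(n) f(n) : f ∈ 2^ℕ } on the first axis whose
-- difference set avoids, away from 0, the finitely many differences of the sums
-- Σⱼ s(wⱼ); hence copies over distinct base points are disjoint. Equality of
-- reals being undecidable, the zero differences cannot be told apart from the
-- others; instead each digit t(n) is placed in an interval that the differences
-- eventually leave, and the later digits are too small to lead out of it.

open import Defs
open import Data.Bool.Base using (Bool; true; false; if_then_else_)
open import Data.Fin.Base using (Fin; zero; suc; funToFin; finToFun; combine)
import Data.Fin.Properties as Fin
import Data.Integer.Base as ℤ
open import Data.List.Base as List using (List)
import Data.List.Membership.Propositional.Properties as Membership
open import Data.List.Membership.Propositional using () renaming (_∈_ to _∈ℝ_)
open import Data.List.Relation.Unary.All as All using (All)
import Data.List.Relation.Unary.Any as ListAny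
import Data.List.Relation.Unary.Any.Properties as ListAny
open import Data.Maybe.Base as Maybe using (Maybe; just; nothing; fromMaybe; maybe′)
open import Data.Nat.Base as ℕ using (ℕ; zero; suc; NonZero)
open import Data.Nat.Coprimality using (1-coprimeTo)
import Data.Nat.Properties as ℕ
open import Data.Product.Base using (∃; ∃₂; _×_; _,_; proj₁; proj₂)
open import Data.Rational.Base as ℚ using (ℚ; mkℚ; 0ℚ; 1ℚ; ½; ∣_∣; *<*)
import Data.Rational.Properties as ℚ
open import Data.Rational.Solver using (module +-*-Solver)
open import Data.Sum.Base using (_⊎_; inj₁; inj₂; [_,_]′)
open import Data.Vec.Base using (Vec; []; _∷_; _++_; map; lookup; tabulate)
import Data.Vec.Properties as Vec
open import Data.Vec.Relation.Unary.Any using (Any; here; there)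
import Data.Vec.Relation.Unary.Any.Properties as Any
open import Function.Base using (_∘_; id; const)
open import Function.Bundles using (Func; Equivalence)
open import Relation.Binary.Bundles using (Setoid)
open import Relation.Binary.PropositionalEquality
  using (_≡_; _≗_; refl; sym; trans; cong; cong₂; subst; module ≡-Reasoning)
open import Relation.Nullary using (¬_; yes; no; contradiction)
open import Relation.Unary using (_∈_; _⊆_; _≐_; Satisfiable)
open +-*-Solver using (solve; _:+_; _:*_; _:-_; _:=_; :-_; con)

-- Combinatorial lines and the Hales–Jewett theorem

Word : ℕ → ℕ → Set
Word n N = Vec (Fin n) N

-- The letter nothing marks the active coordinates.
Line : ℕ → ℕ → Set
Line n N = Vec (Maybe (Fin n)) N

_at_ : ∀ {n N} → Line n N → Fin n → Word n N
ℓ at i = map (fromMaybe i) ℓ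

Active : ∀ {n N} → Line n N → Set
Active = Any (nothing ≡_)

constant : ∀ {n N} → Word n N → Line n N
constant = map just

-- Renaming by `suc` leaves `zero` as the new letter, about which the theorem for the smaller
-- alphabet says nothing.
widen : ∀ {n N} → Line n N → Line (suc n) N
widen = map (Maybe.map suc)

widen-active : ∀ {n N} {ℓ : Line n N} → Active ℓ → Active (widen ℓ)
widen-active (here refl) = here refl
widen-active (there p)   = there (widen-active p)

constant-at : ∀ {n N} (w : Word n N) i → constant w at i ≡ w
constant-at w i = trans (sym (Vec.map-∘ (fromMaybe i) just w)) (Vec.map-id w)

widen-at : ∀ {n N} (ℓ : Line n N) i → widen ℓ at suc i ≡ map suc (ℓ at i)
widen-at []            i = refl
widen-at (nothing ∷ ℓ) i = cong (suc i ∷_) (widen-at ℓ i)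
widen-at (just j ∷ ℓ)  i = cong (suc j ∷_) (widen-at ℓ i)

++-at : ∀ {n M N} (ℓ : Line n M) (ℓ′ : Line n N) i → (ℓ ++ ℓ′) at i ≡ (ℓ at i) ++ (ℓ′ at i)
++-at ℓ ℓ′ i = Vec.map-++ (fromMaybe i) ℓ ℓ′

funToFin-cong : ∀ {m n} {f g : Fin m → Fin n} → f ≗ g → funToFin f ≡ funToFin g
funToFin-cong {zero}  f≗g = refl
funToFin-cong {suc m} f≗g = cong₂ combine (f≗g zero) (funToFin-cong (f≗g ∘ suc))

wordAt : ∀ {n N} → Fin (n ℕ.^ N) → Word n N
wordAt x = tabulate (finToFun x)

indexOf : ∀ {n N} → Word n N → Fin (n ℕ.^ N)
indexOf w = funToFin (lookup w)

wordAt-indexOf : ∀ {n N} (w : Word n N) → wordAt (indexOf w) ≡ w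
wordAt-indexOf w =
  trans (Vec.tabulate-cong (Fin.finToFun-funToFin (lookup w))) (Vec.tabulate∘lookup w)

-- A colouring of all words of one length becomes a single number, so it can serve as a colour in
-- turn. Pointwise equal colourings get equal codes, which stands in for function extensionality.
encode : ∀ {n N c} → (Word n N → Fin c) → Fin (c ℕ.^ (n ℕ.^ N))
encode χ = funToFin (χ ∘ wordAt)

decode : ∀ {n N c} → Fin (c ℕ.^ (n ℕ.^ N)) → Word n N → Fin c
decode x w = finToFun x (indexOf w)

encode-cong : ∀ {n N c} {χ ψ : Word n N → Fin c} → χ ≗ ψ → encode χ ≡ encode ψ
encode-cong χ≗ψ = funToFin-cong (χ≗ψ ∘ wordAt)

decode-encode : ∀ {n N c} (χ : Word n N → Fin c) → decode (encode χ) ≗ χ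
decode-encode χ w =
  trans (Fin.finToFun-funToFin (χ ∘ wordAt) (indexOf w)) (cong χ (wordAt-indexOf w))

MonochromaticLine : ∀ {n N c} → (Word n N → Fin c) → Set
MonochromaticLine χ = ∃ λ ℓ → Active ℓ × ∃ λ a → ∀ i → χ (ℓ at i) ≡ a

prefixed : ∀ {n c M N} {χ : Word n (M ℕ.+ N) → Fin c} {ψ : Word n N → Fin c} (v : Word n M) →
  (∀ u → χ (v ++ u) ≡ ψ u) → MonochromaticLine ψ → MonochromaticLine χ
prefixed {χ = χ} v eq (ℓ , ℓ-active , a , ℓ-mono) =
  constant v ++ ℓ , Any.++⁺ʳ (constant v) ℓ-active , a , λ i → trans
    (cong χ (trans (++-at (constant v) ℓ i) (cong (_++ (ℓ at i)) (constant-at v i))))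
    (trans (eq (ℓ at i)) (ℓ-mono i))

HalesJewett : ℕ → ℕ → Set
HalesJewett n c = ∃ λ N → ∀ (χ : Word n N → Fin c) → MonochromaticLine χ

-- Lines whose points over the letters suc i are monochromatic, in distinct
-- colours, and which share their point over the letter zero.
record Focused {n N c} (χ : Word (suc n) N → Fin c) (r : ℕ) : Set where
  field
    focus            : Word (suc n) N
    line             : Fin r → Line (suc n) N
    active           : ∀ j → Active (line j)
    meets            : ∀ j → line j at zero ≡ focus
    colour           : Fin r → Fin c
    colour-injective : ∀ {i j} → colour i ≡ colour j → i ≡ j
    monochromatic    : ∀ j i → χ (line j at suc i) ≡ colour j

module _ {n c M N : ℕ} (χ : Word (suc n) (M ℕ.+ N) → Fin c) (L : Line n M) (L-active : Active L)
         (ψ : Word (suc n) N → Fin c) (ψ-eq : ∀ i u → χ (map suc (L at i) ++ u) ≡ ψ u) where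

  private
    join : Line (suc n) N → Line (suc n) (M ℕ.+ N)
    join ℓ = widen L ++ ℓ

    join-at-suc : ∀ ℓ i → χ (join ℓ at suc i) ≡ ψ (ℓ at suc i)
    join-at-suc ℓ i = trans
      (cong χ (trans (++-at (widen L) ℓ (suc i)) (cong (_++ (ℓ at suc i)) (widen-at L i))))
      (ψ-eq i (ℓ at suc i))

  extendFocused : ∀ {r} (F : Focused ψ r) →
    (∀ j → ¬ Focused.colour F j ≡ ψ (Focused.focus F)) → Focused χ (suc r)
  extendFocused {r} F fresh = record
    { focus = (widen L at zero) ++ focus
    -- The new line moves in the prefix only, its suffix held at the old focus; the old lines now
    -- move in prefix and suffix at once. All of them meet where the prefix takes the letter `zero`.
    ; line = λ { zero → join (constant focus) ; (suc j) → join (line j) }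
    ; active = λ { zero → Any.++⁺ˡ (widen-active L-active) ; (suc j) → Any.++⁺ʳ (widen L) (active j) }
    ; meets = λ { zero → trans (++-at (widen L) (constant focus) zero)
                           (cong ((widen L at zero) ++_) (constant-at focus zero))
                ; (suc j) → trans (++-at (widen L) (line j) zero)
                              (cong ((widen L at zero) ++_) (meets j)) }
    ; colour = colour′
    ; colour-injective = injective
    ; monochromatic = λ { zero i → trans (join-at-suc (constant focus) i)
                                     (cong ψ (constant-at focus (suc i)))
                        ; (suc j) i → trans (join-at-suc (line j) i) (monochromatic j i) }
    }
    where
    open Focused F
    colour′ : Fin (suc r) → Fin c
    colour′ zero    = ψ focus
    colour′ (suc j) = colour j
    injective : ∀ {i j} → colour′ i ≡ colour′ j → i ≡ j
    injective {zero}  {zero}  _  = refl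
    injective {zero}  {suc j} eq = contradiction (sym eq) (fresh j)
    injective {suc i} {zero}  eq = contradiction eq (fresh i)
    injective {suc i} {suc j} eq = cong suc (colour-injective eq)

-- The lines of a focused family lack only their point over `zero`, and that point is the focus.
focus-coloured : ∀ {n N c r} {χ : Word (suc n) N → Fin c} (F : Focused χ r) j →
  Focused.colour F j ≡ χ (Focused.focus F) → MonochromaticLine χ
focus-coloured {χ = χ} F j eq = line j , active j , colour j , λ
  { zero → trans (cong χ (meets j)) (sym eq) ; (suc i) → monochromatic j i }
  where open Focused F

-- Induction on `r`. A prefix is coloured by the colouring it induces on suffixes, and a line of
-- prefixes is monochromatic for that. The suffixes supply `r` focused lines, and the prefix line
-- adds another unless the focus repeats a colour.
focusing : ∀ {k} → (∀ c → HalesJewett (suc k) c) → ∀ c r →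
  ∃ λ N → ∀ (χ : Word (suc (suc k)) N → Fin c) → MonochromaticLine χ ⊎ Focused χ r
focusing {k} hj c zero = 0 , λ χ → inj₂ (record
  { focus = [] ; line = λ () ; active = λ () ; meets = λ () ; colour = λ ()
  ; colour-injective = λ { {()} } ; monochromatic = λ () })
focusing {k} hj c (suc r) with focusing hj c r
-- One colour for each colouring of the words of length `N`.
... | N , focus with hj (c ℕ.^ (suc (suc k) ℕ.^ N))
... | M , line = M ℕ.+ N , split
  where
  split : ∀ χ → MonochromaticLine χ ⊎ Focused χ (suc r)
  split χ with line (λ w → encode (λ u → χ (map suc w ++ u)))
  ... | L , L-active , a , L-mono = result
    where
    ψ : Word (suc (suc k)) N → Fin c
    ψ = decode a
    ψ-eq : ∀ i u → χ (map suc (L at i) ++ u) ≡ ψ u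
    ψ-eq i u = trans (sym (decode-encode (λ v → χ (map suc (L at i) ++ v)) u))
      (cong (λ b → decode b u) (L-mono i))
    lower : MonochromaticLine ψ → MonochromaticLine χ
    -- Behind any prefix on `L` over an old letter the suffixes are coloured by `ψ`; one such prefix
    -- is fixed.
    lower = prefixed {χ = χ} (map suc (L at zero)) (ψ-eq zero)
    result : MonochromaticLine χ ⊎ Focused χ (suc r)
    result with focus ψ
    ... | inj₁ ℓ = inj₁ (lower ℓ)
    ... | inj₂ F with Fin.any? (λ j → Focused.colour F j Fin.≟ ψ (Focused.focus F))
    ...   | no fresh     = inj₂ (extendFocused χ L L-active ψ ψ-eq F (λ j eq → fresh (j , eq)))
    ...   | yes (j , eq) = inj₁ (lower (focus-coloured F j eq))

-- Induction on the alphabet. A focused family of `suc c` lines would need `suc c` distinct colours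
-- out of `c`, so `focusing` must give a monochromatic line.
hales-jewett : ∀ k c → HalesJewett (suc k) c
hales-jewett zero    c = 1 , λ χ →
  nothing ∷ [] , here refl , χ (zero ∷ []) , λ { zero → refl }
hales-jewett (suc k) c with focusing (hales-jewett k) c (suc c)
... | N , focus = N , λ χ →
  [ id , (λ F → contradiction (Fin.injective⇒≤ (Focused.colour-injective F)) ℕ.1+n≰n) ]′ (focus χ)

-- A Cantor set avoiding finitely many differences

-- An inequality c < d follows from a < b whenever d - c = b - a, an identity
-- that the ring solver checks in the subtraction-free form d + a = c + b.
transfer-< : ∀ {a b c d} → a ℚ.< b → d ℚ.+ a ≡ c ℚ.+ b → c ℚ.< d
transfer-< {a} {b} {c} {d} a<b eq = ℚ.≰⇒> λ d≤c →
  ℚ.<-irrefl eq (ℚ.+-mono-≤-< d≤c a<b)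

transfer-≤ : ∀ {a b c d} → a ℚ.≤ b → d ℚ.+ a ≡ c ℚ.+ b → c ℚ.≤ d
transfer-≤ {a} {b} {c} {d} a≤b eq = ℚ.≮⇒≥ λ d<c →
  ℚ.<-irrefl eq (ℚ.+-mono-<-≤ d<c a≤b)

p≤∣p∣ : ∀ p → p ℚ.≤ ∣ p ∣
p≤∣p∣ p with ℚ.∣p∣≡p∨∣p∣≡-p p | ℚ.0≤∣p∣ p
... | inj₁ eq | _     = ℚ.≤-reflexive (sym eq)
... | inj₂ eq | 0≤∣p∣ rewrite eq = transfer-≤ (ℚ.+-mono-≤ 0≤∣p∣ 0≤∣p∣)
  (solve 1 (λ p → :- p :+ con (0ℚ ℚ.+ 0ℚ) := p :+ (:- p :+ :- p)) refl p)

∣x-y∣<ε⇒x<y+ε : ∀ {ε} p q → ∣ p ℚ.- q ∣ ℚ.< ε → p ℚ.< q ℚ.+ ε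
∣x-y∣<ε⇒x<y+ε {ε} p q h = transfer-< (ℚ.≤-<-trans (p≤∣p∣ (p ℚ.- q)) h)
  (solve 3 (λ p q e → q :+ e :+ (p :- q) := p :+ e) refl p q ε)

∣x-y∣≡∣y-x∣ : ∀ p q → ∣ p ℚ.- q ∣ ≡ ∣ q ℚ.- p ∣
∣x-y∣≡∣y-x∣ p q = trans (sym (ℚ.∣-p∣≡∣p∣ (p ℚ.- q)))
  (cong ∣_∣ (solve 2 (λ p q → :- (p :- q) := q :- p) refl p q))

∣x-y∣≤r : ∀ {a r} p q → a ℚ.≤ p → p ℚ.≤ a ℚ.+ r → a ℚ.≤ q → q ℚ.≤ a ℚ.+ r → ∣ p ℚ.- q ∣ ℚ.≤ r
∣x-y∣≤r {a} {r} p q a≤p p≤ a≤q q≤ with ℚ.∣p∣≡p∨∣p∣≡-p (p ℚ.- q)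
... | inj₁ eq = subst (ℚ._≤ r) (sym eq) (transfer-≤ (ℚ.+-mono-≤ p≤ a≤q)
  (solve 4 (λ a r p q → r :+ (p :+ a) := (p :- q) :+ (a :+ r :+ q)) refl a r p q))
... | inj₂ eq = subst (ℚ._≤ r) (sym eq) (transfer-≤ (ℚ.+-mono-≤ q≤ a≤p)
  (solve 4 (λ a r p q → r :+ (q :+ a) := (:- (p :- q)) :+ (a :+ r :+ p)) refl a r p q))

-- The rational 1/(n+1): `mkℚ` stores the denominator less one.
recip : ℕ → ℚ
recip n = mkℚ (ℤ.+ 1) n (1-coprimeTo (suc n))

archimedean : ∀ {ε} → 0ℚ ℚ.< ε → ∃ λ n → recip n ℚ.< ε
archimedean {mkℚ (ℤ.+ 0) d _}    (*<* (ℤ.+<+ ()))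
-- The fraction (n+1)/(d+1) exceeds 1/(d+2).
archimedean {mkℚ ℤ.+[1+ n ] d _} _ = suc d , *<* (ℤ.+<+ (ℕ.s≤s (ℕ.s≤s (ℕ.+-monoʳ-≤ d ℕ.z≤n))))
archimedean {mkℚ ℤ.-[1+ n ] d _} (*<* ())

0<p⊓q : ∀ {p q} → 0ℚ ℚ.< p → 0ℚ ℚ.< q → 0ℚ ℚ.< p ℚ.⊓ q
0<p⊓q {p} {q} 0<p 0<q with ℚ.⊓-sel p q
... | inj₁ eq = subst (0ℚ ℚ.<_) (sym eq) 0<p
... | inj₂ eq = subst (0ℚ ℚ.<_) (sym eq) 0<q

0<q-p : ∀ {p q} → p ℚ.< q → 0ℚ ℚ.< q ℚ.- p
0<q-p {p} {q} p<q = transfer-< p<q (solve 2 (λ p q → q :- p :+ p := con 0ℚ :+ q) refl p q)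

0<½* : ∀ {p} → 0ℚ ℚ.< p → 0ℚ ℚ.< ½ ℚ.* p
0<½* {p} 0<p = subst (ℚ._< ½ ℚ.* p) (ℚ.*-zeroʳ ½) (ℚ.*-monoʳ-<-pos ½ 0<p)

½*+½* : ∀ p → ½ ℚ.* p ℚ.+ ½ ℚ.* p ≡ p
½*+½* p = trans (sym (ℚ.*-distribʳ-+ p ½ ½)) (ℚ.*-identityˡ p)

quarters : ∀ lo hi → let r = ½ ℚ.* (½ ℚ.* (hi ℚ.- lo)) in hi ≡ lo ℚ.+ r ℚ.+ r ℚ.+ r ℚ.+ r
quarters lo hi = begin
  hi                                ≡⟨ solve 2 (λ l h → h := l :+ (h :- l)) refl lo hi ⟩
  lo ℚ.+ (hi ℚ.- lo)                ≡⟨ cong (lo ℚ.+_) (sym (½*+½* (hi ℚ.- lo))) ⟩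
  lo ℚ.+ (w ℚ.+ w)                  ≡⟨ cong (λ z → lo ℚ.+ (z ℚ.+ z)) (sym (½*+½* w)) ⟩
  lo ℚ.+ (r ℚ.+ r ℚ.+ (r ℚ.+ r))
    ≡⟨ solve 2 (λ l r → l :+ (r :+ r :+ (r :+ r)) := l :+ r :+ r :+ r :+ r) refl lo r ⟩
  lo ℚ.+ r ℚ.+ r ℚ.+ r ℚ.+ r        ∎
  where
  open ≡-Reasoning
  w = ½ ℚ.* (hi ℚ.- lo)
  r = ½ ℚ.* w

p≤p+q : ∀ p {q} → 0ℚ ℚ.< q → p ℚ.≤ p ℚ.+ q
p≤p+q p {q} 0<q = subst (ℚ._≤ p ℚ.+ q) (ℚ.+-identityʳ p) (ℚ.+-monoʳ-≤ p (ℚ.<⇒≤ 0<q))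

-- Phrased by inequalities between rational terms, so that deciding one comparison of rationals can
-- establish it.
Avoids : ℝ → ℚ → ℚ → Set
Avoids x lo hi = ∃ λ M → ∀ n → M ℕ.≤ n → seq x n ℚ.< lo ⊎ hi ℚ.< seq x n

Avoids-⊆ : ∀ {x lo lo′ hi′ hi} → lo ℚ.≤ lo′ → hi′ ℚ.≤ hi → Avoids x lo hi → Avoids x lo′ hi′
Avoids-⊆ lo≤ ≤hi (M , h) = M , λ n M≤n →
  [ (λ l → inj₁ (ℚ.<-≤-trans l lo≤)) , (λ r → inj₂ (ℚ.≤-<-trans ≤hi r)) ]′ (h n M≤n)

stays-below : ∀ {ε m q} x y → x ℚ.≤ m → ∣ y ℚ.- x ∣ ℚ.< ε → ε ℚ.≤ q ℚ.- m → y ℚ.< q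
stays-below {ε} {m} {q} x y x≤m y-x<ε ε≤q-m = transfer-<
  (ℚ.+-mono-<-≤ (∣x-y∣<ε⇒x<y+ε y x y-x<ε) (ℚ.+-mono-≤ x≤m ε≤q-m))
  (solve 5 (λ e m q x y → q :+ (y :+ (x :+ e)) := y :+ (x :+ e :+ (m :+ (q :- m)))) refl ε m q x y)

stays-above : ∀ {ε m p} x y → m ℚ.< x → ∣ x ℚ.- y ∣ ℚ.< ε → ε ℚ.≤ m ℚ.- p → p ℚ.< y
stays-above {ε} {m} {p} x y m<x x-y<ε ε≤m-p = transfer-<
  (ℚ.+-mono-<-≤ (∣x-y∣<ε⇒x<y+ε x y x-y<ε) (ℚ.+-mono-≤ (ℚ.<⇒≤ m<x) ε≤m-p))
  (solve 5 (λ e m p x y → y :+ (x :+ (m :+ e)) := p :+ (y :+ e :+ (x :+ (m :- p)))) refl ε m p x y)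

-- x lies eventually below q or eventually above p, and both [q , hi] and
-- [lo , p] are nondegenerate.
shrink : ∀ x {lo hi} → lo ℚ.< hi →
  ∃₂ λ lo′ hi′ → lo ℚ.≤ lo′ × lo′ ℚ.< hi′ × hi′ ℚ.≤ hi × Avoids x lo′ hi′
shrink x {lo} {hi} lo<hi =
  let m , lo<m , m<hi = ℚ.<-dense lo<hi
      p , lo<p , p<m  = ℚ.<-dense lo<m
      q , m<q , q<hi  = ℚ.<-dense m<hi
      ε               = (q ℚ.- m) ℚ.⊓ (m ℚ.- p)
      K , close       = isCauchy x ε (0<p⊓q (0<q-p m<q) (0<q-p p<m))
  in cases m p q lo<p p<m m<q q<hi ε (ℚ.p⊓q≤p (q ℚ.- m) (m ℚ.- p)) (ℚ.p⊓q≤q (q ℚ.- m) (m ℚ.- p)) K close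
  where
  cases : ∀ m p q → lo ℚ.< p → p ℚ.< m → m ℚ.< q → q ℚ.< hi → ∀ ε → ε ℚ.≤ q ℚ.- m → ε ℚ.≤ m ℚ.- p →
    ∀ K → (∀ i j → K ℕ.≤ i → K ℕ.≤ j → ∣ seq x i ℚ.- seq x j ∣ ℚ.< ε) →
    ∃₂ λ lo′ hi′ → lo ℚ.≤ lo′ × lo′ ℚ.< hi′ × hi′ ℚ.≤ hi × Avoids x lo′ hi′
  -- As `ε` is at most both gaps around `m`, the side of `m` on which the single term `seq x K`
  -- falls controls all later terms.
  cases m p q lo<p p<m m<q q<hi ε ε≤q-m ε≤m-p K close with seq x K ℚ.≤? m
  ... | yes xK≤m = q , hi , ℚ.<⇒≤ (ℚ.<-trans lo<p (ℚ.<-trans p<m m<q)) , q<hi , ℚ.≤-refl , K , λ n K≤n →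
    inj₁ (stays-below (seq x K) (seq x n) xK≤m (close n K K≤n ℕ.≤-refl) ε≤q-m)
  ... | no xK≰m = lo , p , ℚ.≤-refl , lo<p , ℚ.<⇒≤ (ℚ.<-trans p<m (ℚ.<-trans m<q q<hi)) , K , λ n K≤n →
    inj₂ (stays-above (seq x K) (seq x n) (ℚ.≰⇒> xK≰m) (close K n ℕ.≤-refl K≤n) ε≤m-p)

shrinkAll : ∀ xs {lo hi} → lo ℚ.< hi →
  ∃₂ λ lo′ hi′ → lo ℚ.≤ lo′ × lo′ ℚ.< hi′ × hi′ ℚ.≤ hi × All (λ x → Avoids x lo′ hi′) xs
shrinkAll List.[] {lo} {hi} lo<hi = lo , hi , ℚ.≤-refl , lo<hi , ℚ.≤-refl , All.[]
shrinkAll (x List.∷ xs) lo<hi =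
  let l , h , lo≤l , l<h , h≤hi , avoids    = shrinkAll xs lo<hi
      l′ , h′ , l≤l′ , l′<h′ , h′≤h , avoid = shrink x l<h
  in l′ , h′ , ℚ.≤-trans lo≤l l≤l′ , l′<h′ , ℚ.≤-trans h′≤h h≤hi ,
     avoid All.∷ All.map (λ {y} → Avoids-⊆ {y} l≤l′ h′≤h) avoids

-- The later digits move a difference of partial sums by at most radius, so the
-- margin of two radii keeps it bounded away from the δs.
record Digit (δs : List ℝ) (R radius : ℚ) : Set where
  field
    value lo hi : ℚ
    value>0   : 0ℚ ℚ.< value
    fits      : value ℚ.+ radius ℚ.≤ R
    lo-margin : value ≡ lo ℚ.+ radius ℚ.+ radius
    hi-margin : hi ≡ value ℚ.+ radius ℚ.+ radius
    avoids    : All (λ δ → Avoids δ lo hi) δs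

-- The value is the midpoint of the interval and the radius a quarter of its width, which leaves two
-- radii on either side.
middleDigit : ∀ {δs R bound} lo hi → 0ℚ ℚ.≤ lo → lo ℚ.< hi → hi ℚ.≤ R → hi ℚ.≤ bound →
  All (λ δ → Avoids δ lo hi) δs →
  ∃ λ radius → 0ℚ ℚ.< radius × radius ℚ.≤ bound × Digit δs R radius
middleDigit lo hi 0≤lo lo<hi hi≤R hi≤bound avoids = r , 0<r , ℚ.≤-trans r≤hi hi≤bound , record
  { value     = lo ℚ.+ r ℚ.+ r
  ; lo        = lo
  ; hi        = hi
  ; value>0   = ℚ.+-mono-< 0<lo+r 0<r
  ; fits      = ℚ.≤-trans value+r≤hi hi≤R
  ; lo-margin = refl
  ; hi-margin = hi≡
  ; avoids    = avoids
  }
  where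
  r = ½ ℚ.* (½ ℚ.* (hi ℚ.- lo))
  0<r : 0ℚ ℚ.< r
  0<r = 0<½* (0<½* (0<q-p lo<hi))
  0<lo+r : 0ℚ ℚ.< lo ℚ.+ r
  0<lo+r = ℚ.+-mono-≤-< 0≤lo 0<r
  hi≡ : hi ≡ lo ℚ.+ r ℚ.+ r ℚ.+ r ℚ.+ r
  hi≡ = quarters lo hi
  value+r≤hi : lo ℚ.+ r ℚ.+ r ℚ.+ r ℚ.≤ hi
  value+r≤hi = subst (lo ℚ.+ r ℚ.+ r ℚ.+ r ℚ.≤_) (sym hi≡) (p≤p+q _ 0<r)
  r≤hi : r ℚ.≤ hi
  r≤hi = ℚ.≤-trans (subst (r ℚ.≤_) (ℚ.+-comm r (lo ℚ.+ r ℚ.+ r))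
    (p≤p+q r (ℚ.+-mono-< 0<lo+r 0<r))) value+r≤hi

digit : ∀ δs {R bound} → 0ℚ ℚ.< R → 0ℚ ℚ.< bound →
  ∃ λ radius → 0ℚ ℚ.< radius × radius ℚ.≤ bound × Digit δs R radius
digit δs {R} {bound} 0<R 0<bound =
  let lo , hi , 0≤lo , lo<hi , hi≤ , avoids = shrinkAll δs (0<p⊓q 0<R 0<bound)
  -- The search starts from the interval between 0 and the minimum of `R` and `bound`, so `hi`
  -- respects both limits.
  in middleDigit lo hi 0≤lo lo<hi (ℚ.≤-trans hi≤ (ℚ.p⊓q≤p R bound)) (ℚ.≤-trans hi≤ (ℚ.p⊓q≤q R bound)) avoids

-- By `fits`, digit `n` plus `radius (suc n)` is at most `radius n`; thus `radius n` bounds every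
-- sum of digits from place `n` on. The bound by `recip` makes the digit sums Cauchy.
record Digits (δs : List ℝ) : Set where
  field
    radius   : ℕ → ℚ
    radius>0 : ∀ n → 0ℚ ℚ.< radius n
    radius≤  : ∀ n → radius (suc n) ℚ.≤ recip n
    digits   : ∀ n → Digit δs (radius n) (radius (suc n))

chooseDigits : ∀ δs → Digits δs
chooseDigits δs = record
  { radius   = λ n → proj₁ (radii n)
  ; radius>0 = λ n → proj₂ (radii n)
  ; radius≤  = λ n → proj₁ (proj₂ (proj₂ (next (radii n) n)))
  ; digits   = λ n → proj₂ (proj₂ (proj₂ (next (radii n) n)))
  }
  where
  next : (R : ∃ (0ℚ ℚ.<_)) → ∀ n →
    ∃ λ radius → 0ℚ ℚ.< radius × radius ℚ.≤ recip n × Digit δs (proj₁ R) radius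
  next (_ , 0<R) n = digit δs 0<R (ℚ.positive⁻¹ (recip n))
  radii : ℕ → ∃ (0ℚ ℚ.<_)
  radii zero    = 1ℚ , ℚ.positive⁻¹ 1ℚ
  radii (suc n) = let r , 0<r , _ = next (radii n) n in r , 0<r

module CantorSet {δs : List ℝ} (D : Digits δs) where

  open Digits D renaming (radius to R; radius>0 to R>0)

  t : ℕ → ℚ
  t n = Digit.value (digits n)

  partialSum : (ℕ → Bool) → ℕ → ℚ
  partialSum f zero    = 0ℚ
  partialSum f (suc n) = partialSum f n ℚ.+ (if f n then t n else 0ℚ)

  partialSum-cong : ∀ {f g} n → (∀ {i} → i ℕ.< n → f i ≡ g i) → partialSum f n ≡ partialSum g n
  partialSum-cong zero    f≡g = refl
  partialSum-cong (suc n) f≡g = cong₂ (λ s b → s ℚ.+ (if b then t n else 0ℚ))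
    (partialSum-cong n (f≡g ∘ ℕ.m<n⇒m<1+n)) (f≡g (ℕ.n<1+n n))

  -- By `fits`, the interval of length `R n` above the n-th partial sum contains the next one,
  -- whether or not the digit is taken.
  nested : ∀ f {n m} → n ℕ.≤′ m →
    partialSum f n ℚ.≤ partialSum f m ×
    partialSum f m ℚ.+ R m ℚ.≤ partialSum f n ℚ.+ R n
  nested f ℕ.≤′-refl = ℚ.≤-refl , ℚ.≤-refl
  nested f {n} (ℕ.≤′-step {m} n≤m) with nested f n≤m | step
    where
    s = partialSum f m
    step : s ℚ.≤ partialSum f (suc m) × partialSum f (suc m) ℚ.+ R (suc m) ℚ.≤ s ℚ.+ R m
    step with f m
    ... | true =
      transfer-≤ (ℚ.<⇒≤ (Digit.value>0 (digits m)))
        (solve 2 (λ s t → s :+ t :+ con 0ℚ := s :+ t) refl s (t m)) ,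
      transfer-≤ (Digit.fits (digits m))
        (solve 4 (λ s t r R → s :+ R :+ (t :+ r) := s :+ t :+ r :+ R) refl s (t m) (R (suc m)) (R m))
    ... | false =
      ℚ.≤-reflexive (sym (ℚ.+-identityʳ s)) ,
      transfer-≤ (ℚ.+-mono-≤ (Digit.fits (digits m)) (ℚ.<⇒≤ (Digit.value>0 (digits m))))
        (solve 4 (λ s t r R → s :+ R :+ (t :+ r :+ con 0ℚ) := s :+ con 0ℚ :+ r :+ (R :+ t)) refl
          s (t m) (R (suc m)) (R m))
  ... | l , u | l′ , u′ = ℚ.≤-trans l l′ , ℚ.≤-trans u′ u

  partialSum-bounds : ∀ f {n m} → n ℕ.≤ m →
    partialSum f n ℚ.≤ partialSum f m × partialSum f m ℚ.≤ partialSum f n ℚ.+ R n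
  partialSum-bounds f {n} {m} n≤m with nested f (ℕ.≤⇒≤′ n≤m)
  ... | l , u = l , ℚ.≤-trans (transfer-≤ (ℚ.<⇒≤ (R>0 m))
    (solve 2 (λ s r → s :+ r :+ con 0ℚ := s :+ r) refl (partialSum f m) (R m))) u

  cantor : (ℕ → Bool) → ℝ
  cantor f = mkℝ (partialSum f) cauchy
    where
    cauchy : IsCauchy (partialSum f)
    cauchy ε 0<ε with archimedean 0<ε
    -- `radius≤` bounds `R (suc N)` by 1/(N+1), hence the index `suc N`.
    ... | N , 1/N<ε = suc N , λ m n N<m N<n →
      let l , u = partialSum-bounds f N<m ; l′ , u′ = partialSum-bounds f N<n in
      ℚ.≤-<-trans (∣x-y∣≤r (partialSum f m) (partialSum f n) l u l′ u′)
        (ℚ.≤-<-trans (radius≤ N) 1/N<ε)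

  -- The tails after place `j` change the difference of partial sums by at most one radius from
  -- `t j`, and the assumed equality costs less than one more. So `δ` would lie within two radii of
  -- `t j`, inside the interval it avoids.
  cantor-gap : ∀ {f g δ j} → δ ∈ℝ δs → cantor f ≃ cantor g + δ →
    (∀ {i} → i ℕ.< j → f i ≡ g i) → f j ≡ true → ¬ g j ≡ false
  cantor-gap {f} {g} {δ} {j} δ∈ f≃g+δ f≡g fj gj
    with All.lookup (Digit.avoids (digits j)) δ∈ | f≃g+δ (R (suc j)) (R>0 (suc j))
  ... | M , avoid | N , close =
    [ below , above ]′ (avoid n (ℕ.≤-trans (ℕ.m≤n⊔m N M) (ℕ.m≤n⊔m (suc j) (N ℕ.⊔ M))))
    where
    -- Late enough for digit `j`, for the closeness and for the avoidance.
    n = suc j ℕ.⊔ (N ℕ.⊔ M)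
    j<n : suc j ℕ.≤ n
    j<n = ℕ.m≤m⊔n (suc j) (N ℕ.⊔ M)
    open Digit (digits j) using (lo; hi; lo-margin; hi-margin)
    a b s d ρ T : ℚ
    a = partialSum f n
    b = partialSum g n
    s = partialSum g j
    d = seq δ n
    ρ = R (suc j)
    T = t j
    f-start : partialSum f (suc j) ≡ s ℚ.+ T
    f-start rewrite fj = cong (ℚ._+ T) (partialSum-cong j f≡g)
    g-start : partialSum g (suc j) ≡ s
    g-start rewrite gj = ℚ.+-identityʳ s
    close′ : ∣ a ℚ.- (b ℚ.+ d) ∣ ℚ.< ρ
    close′ = close n (ℕ.≤-trans (ℕ.m≤m⊔n N M) (ℕ.m≤n⊔m (suc j) (N ℕ.⊔ M)))
    a≥ : s ℚ.+ T ℚ.≤ a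
    a≥ = subst (ℚ._≤ a) f-start (proj₁ (partialSum-bounds f j<n))
    a≤ : a ℚ.≤ s ℚ.+ T ℚ.+ ρ
    a≤ = subst (λ z → a ℚ.≤ z ℚ.+ ρ) f-start (proj₂ (partialSum-bounds f j<n))
    b≥ : s ℚ.≤ b
    b≥ = subst (ℚ._≤ b) g-start (proj₁ (partialSum-bounds g j<n))
    b≤ : b ℚ.≤ s ℚ.+ ρ
    b≤ = subst (λ z → b ℚ.≤ z ℚ.+ ρ) g-start (proj₂ (partialSum-bounds g j<n))
    below : ¬ d ℚ.< lo
    below d<lo = ℚ.<-asym d<lo (transfer-<
      (ℚ.+-mono-≤-< (ℚ.+-mono-≤ a≥ b≤) (∣x-y∣<ε⇒x<y+ε a (b ℚ.+ d) close′))
      (trans (cong (λ z → d ℚ.+ (s ℚ.+ z ℚ.+ b ℚ.+ a)) lo-margin)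
      (solve 6 (λ a b s d ρ l → d :+ (s :+ (l :+ ρ :+ ρ) :+ b :+ a) := l :+ (a :+ (s :+ ρ) :+ (b :+ d :+ ρ)))
        refl a b s d ρ lo)))
    above : ¬ hi ℚ.< d
    above hi<d = ℚ.<-asym hi<d (transfer-<
      (ℚ.+-mono-≤-< (ℚ.+-mono-≤ a≤ b≥)
        (∣x-y∣<ε⇒x<y+ε (b ℚ.+ d) a (subst (ℚ._< ρ) (∣x-y∣≡∣y-x∣ a (b ℚ.+ d)) close′)))
      (trans (cong (λ z → z ℚ.+ (a ℚ.+ s ℚ.+ (b ℚ.+ d))) hi-margin)
      (solve 6 (λ a b s d ρ T → T :+ ρ :+ ρ :+ (a :+ s :+ (b :+ d)) := d :+ (s :+ T :+ ρ :+ b :+ (a :+ ρ)))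
        refl a b s d ρ T)))

  -- Bits are decidable, so agreement is settled place by place from agreement at all earlier
  -- places. A bit set in `f` alone contradicts the first equation, a bit set in `g` alone the
  -- second.
  cantor-injective : ∀ {f g δ δ′} → δ ∈ℝ δs → δ′ ∈ℝ δs →
    cantor f ≃ cantor g + δ → cantor g ≃ cantor f + δ′ → f ≗ g
  cantor-injective {f} {g} {δ} {δ′} δ∈ δ′∈ p q n = agree (suc n) (ℕ.n<1+n n)
    where
    next : ∀ j → (∀ {i} → i ℕ.< j → f i ≡ g i) → f j ≡ g j
    next j h with f j in fj | g j in gj
    ... | true  | true  = refl
    ... | false | false = refl
    ... | true  | false = contradiction gj (cantor-gap {f} {g} {δ} δ∈ p h fj)
    ... | false | true  = contradiction fj (cantor-gap {g} {f} {δ′} δ′∈ q (sym ∘ h) gj)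
    agree : ∀ j {i} → i ℕ.< j → f i ≡ g i
    agree (suc j) i<1+j with ℕ.m≤n⇒m<n∨m≡n (ℕ.s≤s⁻¹ i<1+j)
    ... | inj₁ i<j  = agree j i<j
    ... | inj₂ refl = next j (agree j)

-- Homothetic copies from combinatorial lines

-- Lets an algebraic identity between reals be checked term by term in the rationals.
≗⇒≃ : ∀ {x y} → seq x ≗ seq y → x ≃ y
≗⇒≃ {x} {y} x≗y ε 0<ε = 0 , λ n _ → subst (ℚ._< ε)
  (sym (trans (cong (λ z → ∣ z ℚ.- seq y n ∣) (x≗y n)) (cong ∣_∣ (ℚ.+-inverseʳ (seq y n))))) 0<ε

+-cong : ∀ {x x′ y y′} → x ≃ x′ → y ≃ y′ → x + y ≃ x′ + y′
+-cong {x} {x′} {y} {y′} x≃x′ y≃y′ ε 0<ε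
  with x≃x′ (½ ℚ.* ε) (0<½* 0<ε) | y≃y′ (½ ℚ.* ε) (0<½* 0<ε)
... | M , p | N , q = M ℕ.⊔ N , λ n M⊔N≤n → begin-strict
  ∣ (seq x n ℚ.+ seq y n) ℚ.- (seq x′ n ℚ.+ seq y′ n) ∣
    ≡⟨ cong ∣_∣ (solve 4 (λ a b c d → a :+ b :- (c :+ d) := a :- c :+ (b :- d)) refl
         (seq x n) (seq y n) (seq x′ n) (seq y′ n)) ⟩
  ∣ (seq x n ℚ.- seq x′ n) ℚ.+ (seq y n ℚ.- seq y′ n) ∣
    ≤⟨ ℚ.∣p+q∣≤∣p∣+∣q∣ (seq x n ℚ.- seq x′ n) (seq y n ℚ.- seq y′ n) ⟩
  ∣ seq x n ℚ.- seq x′ n ∣ ℚ.+ ∣ seq y n ℚ.- seq y′ n ∣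
    <⟨ ℚ.+-mono-< (p n (ℕ.≤-trans (ℕ.m≤m⊔n M N) M⊔N≤n)) (q n (ℕ.≤-trans (ℕ.m≤n⊔m M N) M⊔N≤n)) ⟩
  ½ ℚ.* ε ℚ.+ ½ ℚ.* ε
    ≡⟨ ½*+½* ε ⟩
  ε ∎
  where
  open ℚ.≤-Reasoning

rational : ℚ → ℝ
rational q = mkℝ (λ _ → q) λ ε 0<ε → 0 , λ _ _ _ _ →
  subst (ℚ._< ε) (sym (cong ∣_∣ (ℚ.+-inverseʳ q))) 0<ε

infixl 6 _-_
_-_ : ℝ → ℝ → ℝ
x - y = x + rational (ℚ.- 1ℚ) * y

total : ∀ {N} → ℝ → Vec ℝ N → ℝ
total α []       = α
total α (x ∷ xs) = x + total α xs

total-cong : ∀ {a} {A : Set a} {N α β} {s s′ : A → ℝ} → α ≃ β → (∀ i → s i ≃ s′ i) →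
  (w : Vec A N) → total α (map s w) ≃ total β (map s′ w)
total-cong α≃β s≃s′ []      = α≃β
total-cong {α = α} {β} {s} {s′} α≃β s≃s′ (i ∷ w) =
  +-cong {s i} {s′ i} {total α (map s w)} {total β (map s′ w)}
    (s≃s′ i) (total-cong {s = s} {s′} α≃β s≃s′ w)

-- Brings a sampled coordinate into the form of base point plus word sum, to which separation
-- applies.
total-shift : ∀ {N} α (xs : Vec ℝ N) n → seq (total α xs) n ≡ seq α n ℚ.+ seq (total 0ℝ xs) n
total-shift α []       n = sym (ℚ.+-identityʳ (seq α n))
total-shift α (x ∷ xs) n rewrite total-shift α xs n =
  solve 3 (λ x a t → x :+ (a :+ t) := a :+ (x :+ t)) refl (seq x n) (seq α n) (seq (total 0ℝ xs) n)

-- With `slope`, the coefficients of the affine function of `x` obtained by giving every active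
-- coordinate the value `x`.
intercept : ∀ {k N} → ℝ → (Fin k → ℝ) → Line k N → ℝ
intercept α s ℓ = total α (map (maybe′ s 0ℝ) ℓ)

slope : ∀ {k N} → Line k N → ℝ
slope ℓ = total 0ℝ (map (maybe′ (const 0ℝ) (rational 1ℚ)) ℓ)

slope-nonNegative : ∀ {k N} (ℓ : Line k N) n → 0ℚ ℚ.≤ seq (slope ℓ) n
slope-nonNegative []            n = ℚ.≤-refl
slope-nonNegative (nothing ∷ ℓ) n = ℚ.+-mono-≤ (ℚ.<⇒≤ (ℚ.positive⁻¹ 1ℚ)) (slope-nonNegative ℓ n)
slope-nonNegative (just _ ∷ ℓ)  n = ℚ.+-mono-≤ (ℚ.≤-refl {0ℚ}) (slope-nonNegative ℓ n)

1≤slope : ∀ {k N} {ℓ : Line k N} → Active ℓ → ∀ n → 1ℚ ℚ.≤ seq (slope ℓ) n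
1≤slope {ℓ = _ ∷ ℓ}       (here refl) n = ℚ.+-mono-≤ (ℚ.≤-refl {1ℚ}) (slope-nonNegative ℓ n)
1≤slope {ℓ = nothing ∷ ℓ} (there p)   n =
  ℚ.+-mono-≤ (ℚ.<⇒≤ (ℚ.positive⁻¹ 1ℚ)) (1≤slope p n)
1≤slope {ℓ = just _ ∷ ℓ}  (there p)   n = ℚ.+-mono-≤ (ℚ.≤-refl {0ℚ}) (1≤slope p n)

slope≄0 : ∀ {k N} {ℓ : Line k N} → Active ℓ → ¬ slope ℓ ≃ 0ℝ
slope≄0 {ℓ = ℓ} active ℓ≃0 with ℓ≃0 1ℚ (ℚ.positive⁻¹ 1ℚ)
... | N , small = ℚ.<-irrefl refl (ℚ.≤-<-trans (1≤slope active N)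
  (subst (seq (slope ℓ) N ℚ.<_) (ℚ.+-identityˡ 1ℚ)
    (∣x-y∣<ε⇒x<y+ε (seq (slope ℓ) N) 0ℚ (small N ℕ.≤-refl))))

total-line : ∀ {k N} α (s : Fin k → ℝ) x (ℓ : Line k N) →
  total α (map (maybe′ s x) ℓ) ≃ intercept α s ℓ + slope ℓ * x
total-line α s x ℓ = ≗⇒≃ {total α (map (maybe′ s x) ℓ)} {intercept α s ℓ + slope ℓ * x} (pointwise ℓ)
  where
  pointwise : ∀ {N} (ℓ : Line _ N) →
    seq (total α (map (maybe′ s x) ℓ)) ≗ seq (intercept α s ℓ + slope ℓ * x)
  pointwise []            n =
    solve 2 (λ a x → a := a :+ con 0ℚ :* x) refl (seq α n) (seq x n)
  pointwise (nothing ∷ ℓ) n rewrite pointwise ℓ n =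
    solve 3 (λ i m x → x :+ (i :+ m :* x) := con 0ℚ :+ i :+ (con 1ℚ :+ m) :* x) refl
      (seq (intercept α s ℓ) n) (seq (slope ℓ) n) (seq x n)
  pointwise (just j ∷ ℓ)  n rewrite pointwise ℓ n =
    solve 4 (λ i m x y → y :+ (i :+ m :* x) := y :+ i :+ (con 0ℚ :+ m) :* x) refl
      (seq (intercept α s ℓ) n) (seq (slope ℓ) n) (seq x n) (seq (s j) n)

total-at : ∀ {k N} α (s : Fin k → ℝ) (ℓ : Line k N) i →
  total α (map (maybe′ s (s i)) ℓ) ≡ total α (map s (ℓ at i))
total-at α s []            i = refl
total-at α s (nothing ∷ ℓ) i = cong (s i +_) (total-at α s ℓ i)
total-at α s (just j ∷ ℓ)  i = cong (s j +_) (total-at α s ℓ i)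

-- A point of the set matches a listed point only up to `≃`, so the affine form is first unfolded at
-- `x`, and `x` is then replaced by `s i` in each active coordinate.
line-point : ∀ {k N} α (s : Fin k → ℝ) (ℓ : Line k N) {p x} i →
  p ≃ intercept α s ℓ + slope ℓ * x → x ≃ s i → p ≃ total α (map s (ℓ at i))
line-point α s ℓ {p} {x} i p≃ x≃ = subst (p ≃_) (total-at α s ℓ i)
  (≃-trans {p} {intercept α s ℓ + slope ℓ * x} {total α (map (maybe′ s (s i)) ℓ)} p≃
    (≃-trans {intercept α s ℓ + slope ℓ * x} {total α (map (maybe′ s x) ℓ)} {total α (map (maybe′ s (s i)) ℓ)}
      (≃-sym {total α (map (maybe′ s x) ℓ)} {intercept α s ℓ + slope ℓ * x} (total-line α s x ℓ))
      (total-cong {s = maybe′ s x} {maybe′ s (s i)} (≃-refl {α})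
        (λ { (just j) → ≃-refl {s j} ; nothing → x≃ }) ℓ)))

-- Disjointness of the translates in positive form: a coincidence forces equality of the bit
-- sequences, in the sense used for the cardinal.
record SeparatedTranslates (xs : List ℝ) : Set where
  field
    embed           : (ℕ → Bool) → ℝ
    embed-cong      : ∀ {f g} → f ≗ g → embed f ≃ embed g
    embed-separated : ∀ {f g x y} → x ∈ℝ xs → y ∈ℝ xs → embed f + x ≃ embed g + y → f ≗ g

subtract : ∀ a b x y → a + x ≃ b + y → a ≃ b + (y - x)
subtract a b x y a+x≃b+y ε 0<ε = let M , close = a+x≃b+y ε 0<ε in
  M , λ n M≤n → subst (λ z → ∣ z ∣ ℚ.< ε)
    (solve 4 (λ a b x y → a :+ x :- (b :+ y) := a :- (b :+ (y :+ con (ℚ.- 1ℚ) :* x))) refl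
      (seq a n) (seq b n) (seq x n) (seq y n))
    (close n M≤n)

separatedTranslates : ∀ xs → SeparatedTranslates xs
separatedTranslates xs = record
  { embed           = cantor
  ; embed-cong      = λ {f} {g} f≗g → ≗⇒≃ {cantor f} {cantor g}
      λ n → partialSum-cong n λ {i} _ → f≗g i
  ; embed-separated = λ {f} {g} {x} {y} x∈ y∈ eq →
      cantor-injective {f} {g} {y - x} {x - y} (difference∈ y∈ x∈) (difference∈ x∈ y∈)
        (subtract (cantor f) (cantor g) x y eq)
        (subtract (cantor g) (cantor f) y x (≃-sym {cantor f + x} {cantor g + y} eq))
  }
  where
  open CantorSet (chooseDigits (List.cartesianProductWith _-_ xs xs))
  -- All ordered differences are listed, since `cantor-injective` takes both signs.
  difference∈ : ∀ {x y} → x ∈ℝ xs → y ∈ℝ xs → x - y ∈ℝ List.cartesianProductWith _-_ xs xs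
  difference∈ = Membership.∈-cartesianProductWith⁺ _-_

wordSums : ∀ {k N} → (Fin k → ℝ) → List ℝ
wordSums {k} {N} s = List.tabulate {n = k ℕ.^ N} (λ i → total 0ℝ (map s (wordAt {N = N} i)))

∈-wordSums : ∀ {k N} (s : Fin k → ℝ) (w : Word k N) → total 0ℝ (map s w) ∈ℝ wordSums {N = N} s
∈-wordSums {N = N} s w = subst (λ v → total 0ℝ (map s v) ∈ℝ wordSums {N = N} s) (wordAt-indexOf w)
  (Membership.∈-tabulate⁺ (indexOf w))

-- The family of monochromatic copies

module Construction (𝒮 : Subset) {k c N : ℕ} (s : Fin k → 𝔼²)
  (covered : ∀ {x} → x ∈ 𝒮 → ∃ λ i → x ≈ s i) (inhabited : Satisfiable 𝒮) (χ : Colouring c)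
  (monoLine : (ψ : Word k N → Fin c) → MonochromaticLine ψ)
  (translates : SeparatedTranslates (wordSums {N = N} (proj₁ ∘ s))) where

  open SeparatedTranslates translates

  s₁ s₂ : Fin k → ℝ
  s₁ = proj₁ ∘ s
  s₂ = proj₂ ∘ s

  point : (ℕ → Bool) → Word k N → 𝔼²
  point f w = total (embed f) (map s₁ w) , total 0ℝ (map s₂ w)

  point-cong : ∀ {f g} → f ≗ g → ∀ w → point f w ≈ point g w
  point-cong {f} {g} f≗g w =
    total-cong {α = embed f} {embed g} {s₁} {s₁} (embed-cong f≗g) (λ i → ≃-refl {s₁ i}) w ,
    ≃-refl {total 0ℝ (map s₂ w)}

  wordColouring : (ℕ → Bool) → Word k N → Fin c
  wordColouring f w = Func.to χ (point f w)

  -- Passing through a finite code makes the line depend only on the values of f.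
  chosen : ∀ f → MonochromaticLine (decode (encode (wordColouring f)))
  chosen f = monoLine (decode (encode (wordColouring f)))

  line : (ℕ → Bool) → Line k N
  line f = proj₁ (chosen f)

  line-active : ∀ f → Active (line f)
  line-active f = proj₁ (proj₂ (chosen f))

  line-monochromatic : ∀ f → ∃ λ a → ∀ i → Func.to χ (point f (line f at i)) ≡ a
  line-monochromatic f with proj₂ (proj₂ (chosen f))
  ... | a , mono = a , λ i → trans (sym (decode-encode (wordColouring f) (line f at i))) (mono i)

  line-cong : ∀ {f g} → f ≗ g → line f ≡ line g
  line-cong {f} {g} f≗g = cong (λ e → proj₁ (monoLine (decode e)))
    (encode-cong {χ = wordColouring f} {wordColouring g} (λ w → Func.cong χ (point-cong {f} {g} f≗g w)))

  centre : (ℕ → Bool) → 𝔼²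
  centre f = intercept (embed f) s₁ (line f) , intercept 0ℝ s₂ (line f)

  copy : (ℕ → Bool) → Subset
  copy f = homothet (centre f) (slope (line f)) 𝒮

  copy-point : ∀ f {p} → p ∈ copy f → ∃ λ i → p ≈ point f (line f at i)
  copy-point f {p} (x , x∈𝒮 , p₁ , p₂) with covered x∈𝒮
  ... | i , x₁ , x₂ = i ,
    line-point (embed f) s₁ (line f) {proj₁ p} {proj₁ x} i p₁ x₁ ,
    line-point 0ℝ s₂ (line f) {proj₂ p} {proj₂ x} i p₂ x₂

  copy-monochromatic : ∀ f → Monochromatic χ (copy f)
  copy-monochromatic f with line-monochromatic f
  ... | a , mono = a , λ {p} p∈ → let i , p≈ = copy-point f {p} p∈ in
    trans (Func.cong χ p≈) (mono i)

  copy-homothetic : ∀ f → copy f HomotheticTo 𝒮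
  copy-homothetic f = centre f , slope (line f) , slope≄0 (line-active f) , (λ p∈ → p∈) , (λ p∈ → p∈)

  -- `line-cong` makes the two lines identical, so the copies differ only through the base point in
  -- the first intercept.
  copy-⊆ : ∀ {f g} → f ≗ g → copy f ⊆ copy g
  copy-⊆ {f} {g} f≗g {p} (x , x∈𝒮 , p₁ , p₂) rewrite sym (line-cong {f} {g} f≗g) = x , x∈𝒮 ,
    ≃-trans {proj₁ p} {intercept (embed f) s₁ ℓ + slope ℓ * proj₁ x} {intercept (embed g) s₁ ℓ + slope ℓ * proj₁ x} p₁
      (+-cong {intercept (embed f) s₁ ℓ} {intercept (embed g) s₁ ℓ} {slope ℓ * proj₁ x} {slope ℓ * proj₁ x}
        (total-cong {α = embed f} {embed g} {maybe′ s₁ 0ℝ} {maybe′ s₁ 0ℝ}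
          (embed-cong f≗g) (λ i → ≃-refl {maybe′ s₁ 0ℝ i}) ℓ)
        (≃-refl {slope ℓ * proj₁ x})) ,
    p₂
    where ℓ = line f

  -- The first coordinate of a common point is a word sum translated by `embed f`, and also one
  -- translated by `embed g`.
  copies-meet : ∀ {f g p} → p ∈ copy f → p ∈ copy g → f ≗ g
  copies-meet {f} {g} {p} p∈f p∈g =
    let i , p≈f , _ = copy-point f {p} p∈f
        j , p≈g , _ = copy-point g {p} p∈g
        w  = line f at i
        w′ = line g at j
        x  = total (embed f) (map s₁ w)
        y  = total (embed g) (map s₁ w′)
        x′ = embed f + total 0ℝ (map s₁ w)
        y′ = embed g + total 0ℝ (map s₁ w′)
    in embed-separated {f} {g} {total 0ℝ (map s₁ w)} {total 0ℝ (map s₁ w′)} (∈-wordSums s₁ w) (∈-wordSums s₁ w′)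
      (≃-trans {x′} {x} {y′} (≗⇒≃ {x′} {x} (sym ∘ total-shift (embed f) (map s₁ w)))
        (≃-trans {x} {y} {y′} (≃-trans {x} {proj₁ p} {y} (≃-sym {proj₁ p} {x} p≈f) p≈g)
          (≗⇒≃ {y} {y′} (total-shift (embed g) (map s₁ w′)))))

  copy-inhabited : ∀ f → Satisfiable (copy f)
  copy-inhabited f =
    let x , x∈𝒮 = inhabited
        p = centre f +ᵥ slope (line f) • x
    in p , x , x∈𝒮 , Setoid.refl 𝔼²ₛ {p}

  -- Membership is literal equality with a copy; identifying subsets with the same points is left to
  -- `Members`.
  copies : Family
  copies X = ∃ λ f → X ≡ copy f

  copy-cong : ∀ {f g} → f ≗ g → copy f ≐ copy g
  copy-cong {f} {g} f≗g =
    (λ {p} → copy-⊆ {f} {g} f≗g {p}) , (λ {p} → copy-⊆ {g} {f} (sym ∘ f≗g) {p})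

  -- A nonempty set has nonempty copies, so equal copies share a point.
  copy-injective : ∀ {f g} → copy f ≐ copy g → f ≗ g
  copy-injective {f} {g} (f⊆g , _) =
    let p , p∈ = copy-inhabited f in copies-meet {f} {g} {p} p∈ (f⊆g {p} p∈)

  copies-cardinality : HasCardinality2^ℵ₀ copies
  copies-cardinality = record
    { to        = λ f → copy f , f , refl
    ; cong      = λ {f} {g} → copy-cong {f} {g}
    ; bijective = (λ {f} {g} → copy-injective {f} {g}) ,
                  λ { (_ , f , refl) → f , λ {g} → copy-cong {g} {f} }
    }

  copies-disjoint : PairwiseDisjoint copies
  copies-disjoint (f , refl) (g , refl) f≢g {p} (p∈f , p∈g) =
    f≢g (copy-cong {f} {g} (copies-meet {f} {g} {p} p∈f p∈g))

theorem1p6 : (𝒮 : Subset) → IsFinite 𝒮 → Satisfiable 𝒮 →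
    (c : ℕ) → .{{_ : NonZero c}} → (χ : Colouring c) →
    ∃ λ (𝓕 : Family) →
    HasCardinality2^ℵ₀ 𝓕 ×
    PairwiseDisjoint 𝓕 ×
    (∀ X → X ∈ 𝓕 → Monochromatic χ X × X HomotheticTo 𝒮)
-- The given point rules out an empty enumeration, so the alphabet has the form `suc k` that
-- `hales-jewett` takes.
theorem1p6 𝒮 (List.[] , enumerates) (x , x∈𝒮) c χ =
  contradiction (Equivalence.to (enumerates x) x∈𝒮) λ ()
theorem1p6 𝒮 (y List.∷ ys , enumerates) inhabited c χ =
  copies , copies-cardinality , copies-disjoint ,
  λ { _ (f , refl) → copy-monochromatic f , copy-homothetic f }
  where
  covered : ∀ {x} → x ∈ 𝒮 → ∃ λ i → x ≈ List.lookup (y List.∷ ys) i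
  covered {x} x∈𝒮 = ListAny.index x∈ , ListAny.lookup-index x∈
    where x∈ = Equivalence.to (enumerates x) x∈𝒮
  s : Fin (suc (List.length ys)) → 𝔼²
  s = List.lookup (y List.∷ ys)
  HJ : HalesJewett (suc (List.length ys)) c
  HJ = hales-jewett (List.length ys) c
  open Construction 𝒮 s covered inhabited χ (proj₂ HJ) (separatedTranslates (wordSums (proj₁ ∘ s)))
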